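{- Let $(G,w)$ be a distinct weighted pair graph with vertex set $V$ and arc set $A$, and put $n=|V|$ and $q=|A|$ (so each undirected edge is counted twice in $q$). Then there exists a decreasing trail of $(G,w)$ of length exactly $\lfloor q/n\rfloor$.
   Context: Let $U$ be a linearly ordered set. A distinct weighted pair graph consists of a digraph $G=(V,A)$ with $V\subseteq U$ finite, $|V|\ge 1$, $A\subseteq V\times V$, without loops ($(x,x)\notin A$) and symmetric ($(x,y)\in A\Rightarrow (y,x)\in A$), so that $q=|A|$ is even, together with a function $w:U\times U\to\mathbb{R}$ such that: (i) $w(e)\in\{1,2,\ldots,q/2\}$ for every $e\in A$; (ii) for all $v_1,v_2\in U$: $(v_1,v_2)\notin A$ if and only if $w(v_1,v_2)=0$; (iii) for all $(v_1,v_2),(u_1,u_2)\in A$: $w(v_1,v_2)=w(u_1,u_2)$ if and only if $(v_1,v_2)=(u_1,u_2)$ or $(v_1,v_2)=(u_2,u_1)$. A decreasing trail of $(G,w)$ of length $k\ge 0$ is a list $[(x_1,y_1),\ldots,(x_k,y_k)]$ of arcs in $A$ with $y_i=x_{i+1}$ and $w(x_i,y_i)>w(x_{i+1},y_{i+1})$ for all $1\le i<k$. -}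

module Defs where

open import Data.List using (List; length)
open import Data.List.Membership.Propositional using (_∈_; _∉_)
open import Data.List.Relation.Unary.All using (All)
open import Data.List.Relation.Unary.Linked using (Linked)
open import Data.List.Relation.Unary.Unique.Propositional using (Unique)
open import Data.Nat using (ℕ; _≤_; _>_; _≥_; _/_; NonZero; >-nonZero)
open import Data.Product using (_×_; _,_; proj₁; proj₂)
open import Data.Sum using (_⊎_)
open import Function.Bundles using (_⇔_)
open import Level using (Level)
open import Relation.Binary.PropositionalEquality using (_≡_)

-- Finite subsets of U and of U × U are duplicate-free lists, so that their
-- cardinalities are lengths.
record FiniteDigraph {a : Level} (U : Set a) : Set a where
  field
    V        : List U
    A        : List (U × U)
    V-unique : Unique V
    A-unique : Unique A
    A⊆V×V    : ∀ {x y} → (x , y) ∈ A → x ∈ V × y ∈ V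

  n : ℕ
  n = length V

  q : ℕ
  q = length A

-- The weight function may be taken ℕ-valued instead of ℝ-valued: w-range and
-- w-zero together force every value of a real-valued w into {0, 1, …, q / 2}.
-- That q is even follows from loopless and symmetric.
record DistinctWeightedPairGraph {a : Level} (U : Set a) : Set a where
  field
    digraph : FiniteDigraph U

  open FiniteDigraph digraph public

  field
    nonempty   : n ≥ 1
    loopless   : ∀ x → (x , x) ∉ A
    symmetric  : ∀ {x y} → (x , y) ∈ A → (y , x) ∈ A
    w          : U × U → ℕ
    w-range    : ∀ {e} → e ∈ A → 1 ≤ w e × w e ≤ q / 2
    w-zero     : ∀ v₁ v₂ → (v₁ , v₂) ∉ A ⇔ w (v₁ , v₂) ≡ 0
    w-distinct : ∀ {v₁ v₂ u₁ u₂} → (v₁ , v₂) ∈ A → (u₁ , u₂) ∈ A →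
                 w (v₁ , v₂) ≡ w (u₁ , u₂) ⇔
                 ((v₁ , v₂) ≡ (u₁ , u₂) ⊎ (v₁ , v₂) ≡ (u₂ , u₁))

  instance
    n-nonZero : NonZero n
    n-nonZero = >-nonZero nonempty

  DecreasingTrail : List (U × U) → Set a
  DecreasingTrail t =
    All (_∈ A) t × Linked (λ e f → proj₂ e ≡ proj₁ f × w e > w f) t

{-# OPTIONS --safe #-}
module Submission where

open import Data.List using (List; []; _∷_; length; filter; map)
open import Data.List.Membership.Propositional using (_∈_; find; lose)
open import Data.List.Membership.Propositional.Properties using (∈-filter⁻)
open import Data.List.Properties using (filter-all; filter-none; map-cong-local)
open import Data.List.Relation.Unary.All as All using ([]; _∷_)
open import Data.List.Relation.Unary.AllPairs using ([]; _∷_)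
open import Data.List.Relation.Unary.Any using (here; there; any?)
open import Data.List.Relation.Unary.Linked using ([]; [-]; _∷_)
open import Data.List.Relation.Unary.Unique.Propositional using (Unique)
open import Data.List.Relation.Unary.Unique.Propositional.Properties using (filter⁺)
open import Data.Nat
  using (ℕ; zero; suc; _+_; _*_; _/_; _<_; _≤?_; _<?_; z≤n; s≤s)
  renaming (_≤_ to _≤ℕ_; _≟_ to _≟ℕ_)
open import Data.Nat.ListAction using (sum)
open import Data.Nat.DivMod using (m/n*n≤m)
open import Data.Nat.Properties
open import Data.Product using (_×_; _,_; proj₁; proj₂; ∃-syntax)
open import Data.Sum using (_⊎_; inj₁; inj₂; [_,_]′; swap)
open import Function.Base using (case_of_)
open import Function.Bundles using (Equivalence)
open import Level using (Level)
open import Relation.Binary using (Rel; IsTotalOrder; DecidableEquality)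
open import Relation.Binary.PropositionalEquality
  using (_≡_; _≢_; refl; sym; trans; cong; cong₂; subst; subst₂; module ≡-Reasoning)
open import Relation.Nullary using (yes; no; contradiction)
open import Relation.Unary using (Pred; Decidable; _⊆_; _∪_)
open import Defs

-- Let ℓ u be the length of some decreasing trail from u using arcs of weight
-- below k. An edge {x , y} of weight k extends the trail at y to one from x and
-- the trail at x to one from y, so exchanging these two labels and adding one to
-- each raises Σ ℓ by 2. Hence Σ ℓ eventually reaches q and some ℓ u is ≥ q / n.

private
  variable
    a ℓ : Level
    X : Set a

-- On equal arguments x ≡ y, both total x y and total y x are total x x, so
-- their tags can only differ when x ≢ y.
totalOrder⇒≟ : {_≤_ : Rel X ℓ} → IsTotalOrder _≡_ _≤_ → DecidableEquality X
totalOrder⇒≟ isTotal x y with IsTotalOrder.total isTotal x y in p | IsTotalOrder.total isTotal y x in r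
... | inj₁ x≤y | inj₁ y≤x = yes (IsTotalOrder.antisym isTotal x≤y y≤x)
... | inj₂ y≤x | inj₂ x≤y = yes (IsTotalOrder.antisym isTotal x≤y y≤x)
... | inj₁ _   | inj₂ _   = no λ { refl → case trans (sym p) r of λ () }
... | inj₂ _   | inj₁ _   = no λ { refl → case trans (sym p) r of λ () }

-- Pigeonhole: three entries with only two possible values would repeat one. This bounds the number
-- of arcs of one weight, which can only be the two orientations of a single edge.
unique-pair-length : {u v : X} {xs : List X} → Unique xs →
                     (∀ {x} → x ∈ xs → x ≡ u ⊎ x ≡ v) → length xs ≤ℕ 2
unique-pair-length {xs = []}         _ _ = z≤n
unique-pair-length {xs = _ ∷ []}     _ _ = s≤s z≤n
unique-pair-length {xs = _ ∷ _ ∷ []} _ _ = ≤-refl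
unique-pair-length {xs = _ ∷ _ ∷ _ ∷ _} ((x≢y ∷ x≢z ∷ _) ∷ (y≢z ∷ _) ∷ _) uv
  with uv (here refl) | uv (there (here refl)) | uv (there (there (here refl)))
... | inj₁ refl | inj₁ refl | _         = contradiction refl x≢y
... | inj₂ refl | inj₂ refl | _         = contradiction refl x≢y
... | inj₁ refl | inj₂ _    | inj₁ refl = contradiction refl x≢z
... | inj₂ refl | inj₁ _    | inj₂ refl = contradiction refl x≢z
... | inj₁ _    | inj₂ refl | inj₂ refl = contradiction refl y≢z
... | inj₂ _    | inj₁ refl | inj₁ refl = contradiction refl y≢z

length-filter-∪ : ∀ {p q r} {P : Pred X p} {Q : Pred X q} {R : Pred X r}
  (P? : Decidable P) (Q? : Decidable Q) (R? : Decidable R) → P ⊆ Q ∪ R → ∀ xs →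
  length (filter P? xs) ≤ℕ length (filter Q? xs) + length (filter R? xs)
length-filter-∪ P? Q? R? P⊆Q∪R [] = z≤n
length-filter-∪ P? Q? R? P⊆Q∪R (x ∷ xs)
  with ih ← length-filter-∪ P? Q? R? P⊆Q∪R xs
  with P? x | Q? x | R? x
... | yes _  | yes _  | yes _  = s≤s (≤-trans ih (+-monoʳ-≤ _ (n≤1+n _)))
... | yes _  | yes _  | no _   = s≤s ih
... | yes _  | no _   | yes _  = ≤-trans (s≤s ih) (≤-reflexive (sym (+-suc _ _)))
... | yes Px | no ¬Qx | no ¬Rx = contradiction (P⊆Q∪R Px) [ ¬Qx , ¬Rx ]′
... | no _   | yes _  | yes _  = m≤n⇒m≤1+n (≤-trans ih (+-monoʳ-≤ _ (n≤1+n _)))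
... | no _   | yes _  | no _   = m≤n⇒m≤1+n ih
... | no _   | no _   | yes _  = ≤-trans ih (+-monoʳ-≤ _ (n≤1+n _))
... | no _   | no _   | no _   = ih

-- If `f x` is below `m`, dropping `x` costs the left side `m` and the right side at most `m`, so
-- the bound survives on the rest; a singleton yields the witness.
average≤some : (f : X → ℕ) (m : ℕ) (xs : List X) → 1 ≤ℕ length xs →
               length xs * m ≤ℕ sum (map f xs) → ∃[ x ] m ≤ℕ f x
average≤some {X = X} f m (x₀ ∷ xs₀) _ = go x₀ xs₀
  where
  go : (x : X) (xs : List X) →
       length (x ∷ xs) * m ≤ℕ sum (map f (x ∷ xs)) → ∃[ y ] m ≤ℕ f y
  go x []       bound = x , subst₂ _≤ℕ_ (+-identityʳ m) (+-identityʳ (f x)) bound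
  go x (y ∷ ys) bound with m ≤? f x
  ... | yes m≤fx = x , m≤fx
  ... | no  m≰fx = go y ys (+-cancelˡ-≤ m _ _ (≤-trans bound (+-monoˡ-≤ _ (≰⇒≥ m≰fx))))

module Update {U : Set a} (_≟_ : DecidableEquality U) where

  infixl 20 _[_≔_]

  _[_≔_] : (U → ℕ) → U → ℕ → U → ℕ
  (f [ x ≔ m ]) u with u ≟ x
  ... | yes _ = m
  ... | no  _ = f u

  update-≡ : ∀ f x m → (f [ x ≔ m ]) x ≡ m
  update-≡ f x m with x ≟ x
  ... | yes _   = refl
  ... | no  x≢x = contradiction refl x≢x

  update-≢ : ∀ f x m {u} → u ≢ x → (f [ x ≔ m ]) u ≡ f u
  update-≢ f x m {u} u≢x with u ≟ x
  ... | yes u≡x = contradiction u≡x u≢x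
  ... | no  _   = refl

  update-elim : ∀ {p} {f x m} (P : U → ℕ → Set p) → P x m → (∀ u → P u (f u)) →
                ∀ u → P u ((f [ x ≔ m ]) u)
  update-elim {x = x} P Pxm Pf u with u ≟ x
  ... | yes refl = Pxm
  ... | no  _    = Pf u

  -- As `xs` has no repetitions, exactly one summand changes. The old value is added on the left to
  -- avoid truncated subtraction.
  sum-update : ∀ f x m {xs} → Unique xs → x ∈ xs →
               sum (map (f [ x ≔ m ]) xs) + f x ≡ sum (map f xs) + m
  sum-update f x m {_ ∷ xs} (x∉xs ∷ _) (here refl) = trans
    (cong₂ (λ s t → s + t + f x) (update-≡ f x m)
      (cong sum (map-cong-local (All.map (λ x≢u → update-≢ f x m (λ u≡x → x≢u (sym u≡x))) x∉xs))))
    (exchange m (sum (map f xs)) (f x))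
    where
    exchange : ∀ i j l → i + j + l ≡ l + j + i
    exchange i j l = trans (+-comm (i + j) l)
      (trans (cong (l +_) (+-comm i j)) (sym (+-assoc l j i)))
  sum-update f x m {u ∷ xs} (u∉xs ∷ xs!) (there x∈xs) = trans
    (cong (λ s → s + sum (map (f [ x ≔ m ]) xs) + f x) (update-≢ f x m (All.lookup u∉xs x∈xs)))
    (trans (+-assoc (f u) _ _)
      (trans (cong (f u +_) (sum-update f x m xs! x∈xs)) (sym (+-assoc (f u) _ _))))

  -- Both new labels are read off the old `f`, so the exchange is simultaneous.
  _⟨_⇆_⟩ : (U → ℕ) → U → U → U → ℕ
  f ⟨ x ⇆ y ⟩ = f [ x ≔ suc (f y) ] [ y ≔ suc (f x) ]

  sum-⇆ : ∀ f {x y xs} → Unique xs → x ∈ xs → y ∈ xs → x ≢ y →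
          sum (map (f ⟨ x ⇆ y ⟩) xs) ≡ 2 + sum (map f xs)
  sum-⇆ f {x} {y} {xs} xs! x∈xs y∈xs x≢y =
    +-cancelʳ-≡ (f y + f x) _ _
      (combine (sum (map f xs)) s₁ _ (f x) (f y)
        (sum-update f x (suc (f y)) xs! x∈xs)
        -- The first update leaves the label at `y` alone because `x ≢ y`, so the value that the
        -- second update replaces is still `f y`.
        (subst (λ z → sum (map (f ⟨ x ⇆ y ⟩) xs) + z ≡ s₁ + suc (f x))
          (update-≢ f x _ (λ y≡x → x≢y (sym y≡x)))
          (sum-update (f [ x ≔ suc (f y) ]) y (suc (f x)) xs! y∈xs)))
    where
    s₁ = sum (map (f [ x ≔ suc (f y) ]) xs)

    combine : ∀ s₀ s₁ s₂ i j → s₁ + i ≡ s₀ + suc j → s₂ + j ≡ s₁ + suc i →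
              s₂ + (j + i) ≡ 2 + s₀ + (j + i)
    combine s₀ s₁ s₂ i j p r = begin
      s₂ + (j + i)         ≡⟨ +-assoc s₂ j i ⟨
      s₂ + j + i           ≡⟨ cong (_+ i) r ⟩
      s₁ + suc i + i       ≡⟨ cong (_+ i) (+-suc s₁ i) ⟩
      suc (s₁ + i) + i     ≡⟨ cong (λ z → suc z + i) p ⟩
      suc (s₀ + suc j) + i ≡⟨ cong (λ z → suc z + i) (+-suc s₀ j) ⟩
      2 + (s₀ + j + i)     ≡⟨ cong (2 +_) (+-assoc s₀ j i) ⟩
      2 + s₀ + (j + i)     ∎
      where open ≡-Reasoning

module Trails {U : Set a} (_≟_ : DecidableEquality U) (G : DistinctWeightedPairGraph U) where

  open DistinctWeightedPairGraph G
  open Update _≟_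

  -- A decreasing trail from `u` of the indexed length. The strict bound `k` on its first weight is
  -- exactly what allows an arc of weight `k` to be put in front.
  data Descent (k : ℕ) (u : U) : ℕ → Set a where
    stop : Descent k u 0
    step : ∀ {v m} → (u , v) ∈ A → w (u , v) < k →
           Descent (w (u , v)) v m → Descent k u (suc m)

  weaken : ∀ {j k u m} → j ≤ℕ k → Descent j u m → Descent k u m
  weaken j≤k stop             = stop
  weaken j≤k (step e∈A w<j d) = step e∈A (<-≤-trans w<j j≤k) d

  -- A prefix of a decreasing trail is one too; this turns a trail that is long enough into one of
  -- exact length.
  truncate : ∀ {k u l m} → l ≤ℕ m → Descent k u m → Descent k u l
  truncate z≤n       _                = stop
  truncate (s≤s l≤m) (step e∈A w<k d) = step e∈A w<k (truncate l≤m d)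

  arcs : ∀ {k u m} → Descent k u m → List (U × U)
  arcs stop                     = []
  arcs {u = u} (step {v} _ _ d) = (u , v) ∷ arcs d

  length-arcs : ∀ {k u m} (d : Descent k u m) → length (arcs d) ≡ m
  length-arcs stop         = refl
  length-arcs (step _ _ d) = cong suc (length-arcs d)

  arcs-trail : ∀ {k u m} (d : Descent k u m) → DecreasingTrail (arcs d)
  arcs-trail stop = [] , []
  arcs-trail (step e∈A _ stop) = e∈A ∷ [] , [-]
  -- The weight bound of the tail, `w<w′`, is the comparison required between the first two arcs.
  arcs-trail (step e∈A _ d@(step _ w<w′ _)) =
    let all , linked = arcs-trail d in e∈A ∷ all , (refl , w<w′) ∷ linked

  light : ℕ → List (U × U)
  light k = filter (λ e → w e <? k) A

  light-suc : ∀ k → length (light (suc k)) ≤ℕ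
                    length (filter (λ e → w e ≟ℕ k) A) + length (light k)
  light-suc k = length-filter-∪ (λ e → w e <? suc k) (λ e → w e ≟ℕ k) (λ e → w e <? k)
    (λ w<1+k → swap (m≤n⇒m<n∨m≡n (m<1+n⇒m≤n w<1+k))) A

  -- Induction on `k`: passing to `suc k` makes the arcs of weight `k` light. If there are none, the
  -- labels stay; otherwise there are at most two, paid for by the gain of 2 from the exchange.
  labelling : ∀ k → ∃[ f ] (∀ u → Descent k u (f u)) × length (light k) ≤ℕ sum (map f V)
  labelling zero = (λ _ → 0) , (λ _ → stop) ,
    ≤-trans (≤-reflexive (cong length (filter-none (λ e → w e <? 0) {A} (All.tabulate λ _ ()))))
            z≤n
  labelling (suc k) with labelling k | any? (λ e → w e ≟ℕ k) A
  ... | f , d , bound | no none = f , (λ u → weaken (n≤1+n k) (d u)) ,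
    ≤-trans (light-suc k)
      (≤-trans (≤-reflexive (cong (λ es → length es + length (light k))
                 (filter-none (λ e → w e ≟ℕ k) (All.tabulate λ e∈A w≡k → none (lose e∈A w≡k)))))
               bound)
  ... | f , d , bound | yes some with find some
  -- Matching `refl` replaces `k` by `w (x , y)`.
  ...   | (x , y) , xy∈A , refl = f ⟨ x ⇆ y ⟩ , descents ,
    ≤-trans (light-suc k)
      (≤-trans (+-mono-≤ (unique-pair-length (filter⁺ (λ e → w e ≟ℕ k) A-unique) xy-or-yx) bound)
               (≤-reflexive (sym (sum-⇆ f V-unique (proj₁ (A⊆V×V xy∈A)) (proj₂ (A⊆V×V xy∈A)) x≢y))))
    where
    x≢y : x ≢ y
    x≢y refl = loopless x xy∈A

    w-yx : w (y , x) ≡ w (x , y)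
    w-yx = Equivalence.from (w-distinct (symmetric xy∈A) xy∈A) (inj₂ refl)

    xy-or-yx : ∀ {e} → e ∈ filter (λ e → w e ≟ℕ k) A → e ≡ (x , y) ⊎ e ≡ (y , x)
    xy-or-yx e∈ = let e∈A , w≡k = ∈-filter⁻ (λ e → w e ≟ℕ k) e∈ in
      Equivalence.to (w-distinct e∈A xy∈A) w≡k

    descents : ∀ u → Descent (suc k) u ((f ⟨ x ⇆ y ⟩) u)
    descents = update-elim (Descent (suc k))
      -- At `y`: take the arc to `x`, then the old trail from `x`, whose bound `w (x , y)` is
      -- rewritten as `w (y , x)`.
      (step (symmetric xy∈A) (s≤s (≤-reflexive w-yx)) (weaken (≤-reflexive (sym w-yx)) (d x)))
      (update-elim (Descent (suc k))
        (step xy∈A ≤-refl (d y))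
        (λ u → weaken (n≤1+n k) (d u)))

  trail : ∃[ t ] (DecreasingTrail t × length t ≡ q / n)
  -- Weights are at most `q / 2`, so below this bound every arc is light and the labels sum to at
  -- least `q`.
  trail with labelling (suc (q / 2))
  ... | f , d , bound with average≤some f (q / n) V nonempty q≤sum
    where
    q≤sum : n * (q / n) ≤ℕ sum (map f V)
    q≤sum = begin
      n * (q / n)                  ≡⟨ *-comm n (q / n) ⟩
      q / n * n                    ≤⟨ m/n*n≤m q n ⟩
      q                            ≡⟨ cong length (filter-all (λ e → w e <? suc (q / 2))
                                        (All.tabulate λ e∈A → s≤s (proj₂ (w-range e∈A)))) ⟨
      length (light (suc (q / 2))) ≤⟨ bound ⟩
      sum (map f V)                ∎
      where open ≤-Reasoning
  ... | u , q/n≤fu = arcs d′ , arcs-trail d′ , length-arcs d′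
    where d′ = truncate q/n≤fu (d u)

mainTheorem9 : {a ℓ : Level} {U : Set a} (_≤_ : Rel U ℓ) → IsTotalOrder _≡_ _≤_ →
    (G : DistinctWeightedPairGraph U) →
    let open DistinctWeightedPairGraph G in
    ∃[ t ] (DecreasingTrail t × length t ≡ q / n)
mainTheorem9 _ isTotal G = Trails.trail (totalOrder⇒≟ isTotal) G
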